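{- Let $m\geq 3$ be an integer and let $p\geq 3$ be an odd prime. Then $$\operatorname{tr}(P_{m,p})=2^p\Big(T\big(a_{m-1}^p,\;a_m+a_{m-1}\big)+2^{m+p-2}-2^{m-2}\Big).$$
   Context: Let $a_i=a_i(c)\in\mathbb{Z}[c]$ be defined by $a_0=0$ and $a_i=a_{i-1}^2+c$ (i.e. $a_i=f_c^i(0)$ with $f_c(z)=z^2+c$). $\mu$ is the Möbius function. For $m\geq 2$, $n\geq 1$, $G_{m,n}\in\mathbb{Z}[c]$ is $\prod_{k\mid n}(a_{m+k-1}+a_{m-1})^{\mu(n/k)}$ if $n\nmid m-1$, and $\prod_{k\mid n}(a_{m+k-1}+a_{m-1})^{\mu(n/k)}\prod_{k\mid n}a_k^{ -\mu(n/k)}$ if $n\mid m-1$ (a monic integer polynomial). For a root $\alpha$ of $G_{m,n}$, $\lambda_{m,n}(\alpha)=2^n\prod_{i=0}^{n-1}a_{m+i}(\alpha)$, and $P_{m,n}(x)=\prod_j(x-\lambda_{m,n}(\alpha_j))$ over all roots $\alpha_j$ of $G_{m,n}$ with multiplicity. For a monic polynomial $P$, $\operatorname{tr}(P)$ is the sum of its roots. For polynomials $f,g$ over a field with $g\neq0$, $T(f,g)$ is the sum of $f(\gamma)$ over all roots $\gamma$ of $g$, counted with multiplicity. -}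

module Defs where

open import Level using (_⊔_)
open import Data.Bool using (Bool; true; false; if_then_else_; _∧_; not)
open import Data.Nat as ℕ using (ℕ; zero; suc; _≡ᵇ_)
open import Data.Nat.Divisibility using (_∣?_)
open import Data.Nat.Primality using (prime?)
open import Data.Integer as ℤ using (ℤ)
open import Data.List using (List; []; _∷_; map; foldr; filterᵇ; upTo; length; cartesianProduct)
open import Data.List.Relation.Unary.All using (All)
open import Data.Product using (_×_; _,_; proj₁; proj₂)
open import Data.Sum using (_⊎_)
open import Data.Empty using (⊥)
open import Relation.Nullary using (¬_; does)
open import Algebra.Bundles using (CommutativeRing)

-- Möbius function (standard definition):
--   μ(n) = 0 if n has a square factor d² with d ≥ 2,
--   μ(n) = (-1)^(number of distinct prime divisors of n) otherwise.
-- (μ(0) is not used; the definition gives 0 there.)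

range1 : ℕ → List ℕ
range1 n = map suc (upTo n)

squarefreeᵇ : ℕ → Bool
squarefreeᵇ zero = false
squarefreeᵇ n = foldr (λ d b → not (does ((d ℕ.* d) ∣? n)) ∧ b) true (filterᵇ (λ d → not (d ≡ᵇ 1)) (range1 n))

numPrimeDivisors : ℕ → ℕ
numPrimeDivisors n = length (filterᵇ (λ q → does (prime? q) ∧ does (q ∣? n)) (range1 n))

negOnePow : ℕ → ℤ
negOnePow zero = ℤ.+ 1
negOnePow (suc k) = ℤ.- negOnePow k

mobius : ℕ → ℤ
mobius n = if squarefreeᵇ n then negOnePow (numPrimeDivisors n) else ℤ.+ 0

divisorPairs : ℕ → List (ℕ × ℕ)
divisorPairs n = filterᵇ (λ kj → (proj₁ kj ℕ.* proj₂ kj) ≡ᵇ n) (cartesianProduct (range1 n) (range1 n))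

divsMobPlus : ℕ → List ℕ
divsMobPlus n = map proj₁ (filterᵇ (λ kj → does (mobius (proj₂ kj) ℤ.≟ ℤ.+ 1)) (divisorPairs n))

divsMobMinus : ℕ → List ℕ
divsMobMinus n = map proj₁ (filterᵇ (λ kj → does (mobius (proj₂ kj) ℤ.≟ ℤ.- ℤ.+ 1)) (divisorPairs n))

-- Polynomials (in the variable c) over a commutative ring R, as
-- coefficient lists, lowest degree first.

module PolyOver {c ℓ} (R : CommutativeRing c ℓ) where
  open CommutativeRing R

  Poly : Set c
  Poly = List Carrier

  infixl 6 _+P_
  infixl 7 _*P_

  _+P_ : Poly → Poly → Poly
  [] +P q = q
  (x ∷ p) +P [] = x ∷ p
  (x ∷ p) +P (y ∷ q) = (x + y) ∷ (p +P q)

  negP : Poly → Poly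
  negP = map (-_)

  _*P_ : Poly → Poly → Poly
  [] *P q = []
  (x ∷ p) *P q = map (x *_) q +P (0# ∷ (p *P q))

  constP : Carrier → Poly
  constP x = x ∷ []

  oneP : Poly
  oneP = constP 1#

  X : Poly
  X = 0# ∷ 1# ∷ []

  _≈P_ : Poly → Poly → Set (c ⊔ ℓ)
  p ≈P q = All (λ x → x ≈ 0#) (p +P negP q)

  prodP : List Poly → Poly
  prodP = foldr _*P_ oneP

  rootsPoly : List Carrier → Poly
  rootsPoly γs = prodP (map (λ γ → X +P constP (- γ)) γs)

  aP : ℕ → Poly
  aP zero = []
  aP (suc i) = aP i *P aP i +P X

  aV : ℕ → Carrier → Carrier
  aV zero γ = 0#
  aV (suc i) γ = aV i γ * aV i γ + γ

  natR : ℕ → Carrier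
  natR zero = 0#
  natR (suc n) = 1# + natR n

  powR : Carrier → ℕ → Carrier
  powR x zero = 1#
  powR x (suc n) = x * powR x n

  sumR : List Carrier → Carrier
  sumR = foldr _+_ 0#

  prodR : List Carrier → Carrier
  prodR = foldr _*_ 1#

  -- G_{m,n} = Num_{m,n} / Den_{m,n}  (the Möbius product split into
  -- factors with exponent +1 and exponent -1)
  termP : ℕ → ℕ → Poly
  termP m k = aP (m ℕ.+ k ℕ.∸ 1) +P aP (m ℕ.∸ 1)

  GNum : ℕ → ℕ → Poly
  GNum m n = prodP (map (termP m) (divsMobPlus n))
             *P (if does (n ∣? (m ℕ.∸ 1)) then prodP (map aP (divsMobMinus n)) else oneP)

  GDen : ℕ → ℕ → Poly
  GDen m n = prodP (map (termP m) (divsMobMinus n))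
             *P (if does (n ∣? (m ℕ.∸ 1)) then prodP (map aP (divsMobPlus n)) else oneP)

  -- G is (the image in R[c] of) G_{m,n}: G · Den = Num  (Den is monic,
  -- so this determines G uniquely)
  IsG : ℕ → ℕ → Poly → Set (c ⊔ ℓ)
  IsG m n G = (G *P GDen m n) ≈P GNum m n

  lam : ℕ → ℕ → Carrier → Carrier
  lam m n α = natR (2 ℕ.^ n) * prodR (map (λ i → aV (m ℕ.+ i) α) (upTo n))

  IsDomain : Set (c ⊔ ℓ)
  IsDomain = (¬ (1# ≈ 0#)) × (∀ x y → x * y ≈ 0# → (x ≈ 0#) ⊎ (y ≈ 0#))

  CharZero : Set ℓ
  CharZero = ∀ n → natR (suc n) ≈ 0# → ⊥

{-# OPTIONS --safe #-}
module Submission where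

-- The sum of f over the roots of a monic polynomial g is the coefficient of
-- degree deg g − 1 of f·g′ modulo g. So it needs no splitting of g, it is additive
-- in g, and it vanishes when g divides f. Apply this to f = a_m ⋯ a_{m+p−1} and to
--   G · (a_m + a_{m−1}) = N := a_{m+p−1} + a_{m−1},
-- or G · (a_m + a_{m−1}) · a_p = N · a_1 if p ∣ m − 1, where a_p and a_1 divide f.
-- At a root of a_m + a_{m−1} all of a_m, a_{m+1}, … equal −a_{m−1}, so f takes the
-- value −a_{m−1}^p. The sum over the roots of N is 2^{m+p−2} − 2^{m−2} by an
-- explicit reduction of f·N′ modulo N.

open import Defs
open import Algebra.Bundles using (CommutativeRing)
import Algebra.Properties.Ring
open import Data.Bool using (Bool; true; T; T?; _∧_; not; if_then_else_)
open import Data.Bool.Properties using (T-∧)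
open import Data.Integer as ℤ using (ℤ)
open import Data.List using (List; []; _∷_; map; length; upTo; applyUpTo; filterᵇ; foldr; cartesianProduct)
open import Data.List.Membership.Propositional using (_∈_)
open import Data.List.Membership.Propositional.Properties
  using (∈-map⁺; ∈-upTo⁺; ∈-filter⁺; ∈-filter⁻; ∈-cartesianProduct⁺)
open import Data.List.Properties using (map-upTo)
open import Data.List.Relation.Unary.All as All using (All; []; _∷_)
open import Data.List.Relation.Unary.AllPairs using (_∷_)
open import Data.List.Relation.Unary.Any using (here; there)
open import Data.List.Relation.Unary.Unique.Propositional using (Unique)
import Data.List.Relation.Unary.Unique.Propositional.Properties as Unique
open import Data.Nat as ℕ using (ℕ; zero; suc; _≤_; _<_; z≤n; s≤s; _∸_; _^_)
open import Data.Nat.Divisibility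
  using (_∣_; _∣?_; divides; ∣-trans; ∣⇒≤; m∣m*n; ∣m∣n⇒∣m+n; ∣-refl; 1∣_)
open import Data.Nat.DivMod using (_%_; _/_; m≡m%n+[m/n]*n; m%n<n)
open import Data.Nat.Primality using (Prime; prime?; ¬prime[1]; prime⇒irreducible; prime⇒nonZero)
import Data.Nat.Properties as ℕ
open import Data.Product using (∃; _×_; _,_; proj₁; proj₂)
open import Data.Sum using (_⊎_; inj₁; inj₂)
open import Function using (_∘_; Equivalence)
open import Level using (_⊔_)
open import Relation.Binary.Definitions using (tri<; tri≈; tri>)
open import Relation.Binary.PropositionalEquality as ≡ using (_≡_)
open import Relation.Nullary using (¬_; Dec; yes; no; does; contradiction)
open import Relation.Nullary.Decidable using (dec-false)

-- Roots in `R` are supplied only for `G` and for a_m + a_{m-1}; when p divides m - 1, the extra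
-- factor a_p need not split there. Hence the comparison runs through coefficients. The trace over N
-- has a closed form because the two ends of the product f meet modulo N: the last factor a_{m+p-1}
-- becomes -a_{m-1}, so f becomes -a_{m-1} a_m ⋯ a_{m+p-2}. This contains b = a_{m+p-2}, which
-- against the term 2bb′ of N′ forms a square, and b² ≡ -(c + a_{m-1}) can be replaced again. What
-- remains already lies below deg N, and its coefficient of degree deg N - 1 is deg N - deg a_{m-1}:
-- this is the origin of 2^{m+p-2} - 2^{m-2}. The bound m ≥ 3 enters as deg a_{m-1} ≥ 2, so that
-- adding c to a_{m-1} leaves its leading term alone.

T-does⁺ : ∀ {a} {A : Set a} (a? : Dec A) → A → T (does a?)
T-does⁺ (yes _) a = _
T-does⁺ (no ¬a) a = ¬a a

T-does⁻ : ∀ {a} {A : Set a} (a? : Dec A) → T (does a?) → A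
T-does⁻ (yes a) _ = a

unique-singleton : ∀ {a} {A : Set a} {v : A} {xs} →
  Unique xs → v ∈ xs → (∀ {x} → x ∈ xs → x ≡ v) → xs ≡ v ∷ []
unique-singleton {xs = x ∷ []}     u v∈ eq = ≡.cong (_∷ []) (eq (here ≡.refl))
unique-singleton {xs = x ∷ y ∷ xs} ((x≢y ∷ _) ∷ _) v∈ eq =
  contradiction (≡.trans (eq (here ≡.refl)) (≡.sym (eq (there (here ≡.refl))))) x≢y

-- With `p` a variable, the filters that define the divisor lists do not compute. Each list is
-- identified instead by having no repetition and only one possible member.
filter-singleton : ∀ {a} {A : Set a} (f : A → Bool) {v : A} {xs} →
  Unique xs → v ∈ xs → T (f v) → (∀ {x} → x ∈ xs → T (f x) → x ≡ v) → filterᵇ f xs ≡ v ∷ []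
filter-singleton f {xs = xs} u v∈ fv eq =
  unique-singleton (Unique.filter⁺ (T? ∘ f) u) (∈-filter⁺ (T? ∘ f) v∈ fv)
    (λ x∈ → let x∈xs , fx = ∈-filter⁻ (T? ∘ f) {xs = xs} x∈ in eq x∈xs fx)

-- Möbius values and divisor lists at a prime.

range1-unique : ∀ n → Unique (range1 n)
range1-unique n = Unique.map⁺ ℕ.suc-injective (Unique.upTo⁺ n)

∈-range1 : ∀ {i n} → i < n → suc i ∈ range1 n
∈-range1 i<n = ∈-map⁺ suc (∈-upTo⁺ i<n)

p∈range1[p] : ∀ {p} → Prime p → p ∈ range1 p
p∈range1[p] {suc p} pp = ∈-range1 (ℕ.n<1+n p)

1∈range1[p] : ∀ {p} → Prime p → 1 ∈ range1 p
1∈range1[p] {suc p} pp = ∈-range1 (s≤s z≤n)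

squarefree-prime : ∀ {p} → Prime p → squarefreeᵇ p ≡ true
-- Exposing the successor lets `squarefreeᵇ` unfold past its clause for zero.
squarefree-prime {p@(suc _)} pp = conj (All.tabulate nonunit-square∤p)
  where
  big : ℕ → Bool
  big d = not (d ℕ.≡ᵇ 1)

  nonunit-square∤p : ∀ {d} → d ∈ filterᵇ big (range1 p) → ¬ (d ℕ.* d ∣ p)
  nonunit-square∤p {d} d∈ dd∣p with ∈-filter⁻ (T? ∘ big) {xs = range1 p} d∈
  ... | _ , d≢1 with prime⇒irreducible pp (∣-trans (m∣m*n {d} d) dd∣p)
  ...   | inj₁ ≡.refl = d≢1
  ...   | inj₂ ≡.refl = contradiction
    (ℕ.*-cancelˡ-≤ p (ℕ.≤-trans (∣⇒≤ dd∣p) (ℕ.≤-reflexive (≡.sym (ℕ.*-identityʳ p)))))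
    (λ p≤1 → ¬prime[1] (≡.subst Prime (ℕ.≤-antisym p≤1 (s≤s z≤n)) pp))

  conj : ∀ {ds} → All (λ d → ¬ (d ℕ.* d ∣ p)) ds →
         foldr (λ d b → not (does ((d ℕ.* d) ∣? p)) ∧ b) true ds ≡ true
  conj []                    = ≡.refl
  conj {d ∷ _} (dd∤p ∷ rest) rewrite dec-false ((d ℕ.* d) ∣? p) dd∤p = conj rest

numPrimeDivisors-prime : ∀ {p} → Prime p → numPrimeDivisors p ≡ 1
numPrimeDivisors-prime {p} pp = ≡.cong length
  (filter-singleton isPrimeDivisor (range1-unique p) (p∈range1[p] pp)
    (Equivalence.from T-∧ (T-does⁺ (prime? p) pp , T-does⁺ (p ∣? p) ∣-refl))
    only)
  where
  isPrimeDivisor : ℕ → Bool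
  isPrimeDivisor q = does (prime? q) ∧ does (q ∣? p)

  only : ∀ {q} → q ∈ range1 p → T (isPrimeDivisor q) → q ≡ p
  only {q} _ t with Equivalence.to T-∧ t
  ... | q-prime , q∣p with prime⇒irreducible pp (T-does⁻ (q ∣? p) q∣p)
  ...   | inj₁ ≡.refl = contradiction (T-does⁻ (prime? q) q-prime) ¬prime[1]
  ...   | inj₂ q≡p    = q≡p

mobius-prime : ∀ {p} → Prime p → mobius p ≡ ℤ.- ℤ.+ 1
mobius-prime pp rewrite squarefree-prime pp | numPrimeDivisors-prime pp = ≡.refl

∈-divisorPairs⁻ : ∀ {n kj} → kj ∈ divisorPairs n → proj₁ kj ℕ.* proj₂ kj ≡ n
∈-divisorPairs⁻ {n} {k , j} kj∈ = ℕ.≡ᵇ⇒≡ (k ℕ.* j) n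
  (proj₂ (∈-filter⁻ (λ kj → T? ((proj₁ kj ℕ.* proj₂ kj) ℕ.≡ᵇ n))
    {xs = cartesianProduct (range1 n) (range1 n)} kj∈))

∈-divisorPairs⁺ : ∀ {n k j} → k ∈ range1 n → j ∈ range1 n → k ℕ.* j ≡ n → (k , j) ∈ divisorPairs n
∈-divisorPairs⁺ {n} {k} {j} k∈ j∈ kj≡n =
  ∈-filter⁺ (λ kj → T? ((proj₁ kj ℕ.* proj₂ kj) ℕ.≡ᵇ n)) (∈-cartesianProduct⁺ k∈ j∈) (ℕ.≡⇒≡ᵇ (k ℕ.* j) n kj≡n)

divisorPairs-unique : ∀ n → Unique (divisorPairs n)
divisorPairs-unique n = Unique.filter⁺ _ (Unique.cartesianProduct⁺ (range1-unique n) (range1-unique n))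

module _ {p} (pp : Prime p) where

  divisors-with-mobius : ∀ (μ : ℤ) {k j} → k ∈ range1 p → j ∈ range1 p → k ℕ.* j ≡ p → mobius j ≡ μ →
    (∀ {k′ j′} → k′ ℕ.* j′ ≡ p → mobius j′ ≡ μ → (k′ , j′) ≡ (k , j)) →
    map proj₁ (filterᵇ (λ kj → does (mobius (proj₂ kj) ℤ.≟ μ)) (divisorPairs p)) ≡ k ∷ []
  divisors-with-mobius μ {k} {j} k∈ j∈ kj≡p μj only = ≡.cong (map proj₁)
    (filter-singleton (λ kj → does (mobius (proj₂ kj) ℤ.≟ μ)) (divisorPairs-unique p)
      (∈-divisorPairs⁺ k∈ j∈ kj≡p) (T-does⁺ (mobius j ℤ.≟ μ) μj)
      (λ {(k′ , j′)} kj∈ t → only (∈-divisorPairs⁻ kj∈) (T-does⁻ (mobius j′ ℤ.≟ μ) t)))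

  divsMobPlus-prime : divsMobPlus p ≡ p ∷ []
  divsMobPlus-prime =
    divisors-with-mobius (ℤ.+ 1) (p∈range1[p] pp) (1∈range1[p] pp) (ℕ.*-identityʳ p) ≡.refl only
    where
    only : ∀ {k j} → k ℕ.* j ≡ p → mobius j ≡ ℤ.+ 1 → (k , j) ≡ (p , 1)
    only {k} {j} kj≡p μj with prime⇒irreducible pp (divides k (≡.sym kj≡p))
    ... | inj₁ ≡.refl = ≡.cong (_, 1) (≡.trans (≡.sym (ℕ.*-identityʳ k)) kj≡p)
    ... | inj₂ ≡.refl = contradiction (≡.trans (≡.sym (mobius-prime pp)) μj) (λ ())

  divsMobMinus-prime : divsMobMinus p ≡ 1 ∷ []
  divsMobMinus-prime =
    divisors-with-mobius (ℤ.- ℤ.+ 1) (1∈range1[p] pp) (p∈range1[p] pp) (ℕ.*-identityˡ p) (mobius-prime pp) only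
    where
    only : ∀ {k j} → k ℕ.* j ≡ p → mobius j ≡ ℤ.- ℤ.+ 1 → (k , j) ≡ (1 , p)
    only {k} {j} kj≡p μj with prime⇒irreducible pp (divides k (≡.sym kj≡p))
    ... | inj₁ ≡.refl = contradiction μj (λ ())
    ... | inj₂ ≡.refl = ≡.cong (_, p) (ℕ.*-cancelʳ-≡ k 1 p {{prime⇒nonZero pp}}
                          (≡.trans kj≡p (≡.sym (ℕ.*-identityˡ p))))

  -- Oddness fixes the sign of (-a_{m-1})^p. The form `suc (j * 2)` lets `powR` split off one factor
  -- and then run through squares.
  prime⇒odd : 3 ≤ p → ∃ λ j → p ≡ suc (j ℕ.* 2)
  prime⇒odd 3≤p with p % 2 | m%n<n p 2 | m≡m%n+[m/n]*n p 2
  ... | 1           | _             | p≡ = p / 2 , p≡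
  ... | suc (suc _) | s≤s (s≤s ()) | _
  ... | 0           | _             | p≡ with prime⇒irreducible pp (divides (p / 2) p≡)
  ...   | inj₂ 2≡p = contradiction 3≤p (ℕ.<⇒≱ (s≤s (ℕ.≤-reflexive (≡.sym 2≡p))))

-- Moving between sums and differences in a commutative ring.

module Rearrangement {c ℓ} (R : CommutativeRing c ℓ) where
  open CommutativeRing R
  open import Algebra.Properties.Ring ring
  open import Algebra.Solver.Ring.NaturalCoefficients.Default commutativeSemiring
    using (solve; _:+_; _:*_; _:=_)
  open import Relation.Binary.Reasoning.Setoid setoid

  subtractʳ : ∀ {x y z} → x + y ≈ z → x ≈ z - y
  subtractʳ {x} {y} {z} e = begin
    x            ≈⟨ +-identityʳ x ⟨
    x + 0#       ≈⟨ +-congˡ (-‿inverseʳ y) ⟨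
    x + (y - y)  ≈⟨ +-assoc x y (- y) ⟨
    (x + y) - y  ≈⟨ +-congʳ e ⟩
    z - y        ∎

  -- A reduction modulo `g` is checked as an equality of sums without signs; this turns it into a
  -- quotient and a remainder.
  isolate : ∀ {x a b g r s} → x + (a * g + r) ≈ b * g + s → x ≈ (b - a) * g + (s - r)
  isolate {x} {a} {b} {g} {r} {s} e = begin
    x                                  ≈⟨ subtractʳ e ⟩
    (b * g + s) - (a * g + r)          ≈⟨ +-congˡ (-‿+-comm (a * g) r) ⟨
    (b * g + s) + (- (a * g) + - r)    ≈⟨ +-congˡ (+-congʳ (-‿distribˡ-* a g)) ⟩
    (b * g + s) + ((- a) * g + - r)    ≈⟨ solve 5 (λ b g s a r →
                                            (b :* g :+ s) :+ (a :* g :+ r) :=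
                                            (b :+ a) :* g :+ (s :+ r)) refl b g s (- a) (- r) ⟩
    (b - a) * g + (s - r)              ∎

  -- Used for uniqueness of traces: two divisions of one element by `g` have remainders that are
  -- congruent modulo `g`.
  cross : ∀ {a b g r s} → a * g + r ≈ b * g + s → r - s ≈ (b - a) * g
  cross {a} {b} {g} {r} {s} e = begin
    r - s                            ≈⟨ +-congʳ (subtractʳ (trans (+-comm r (a * g)) e)) ⟩
    (b * g + s - a * g) - s          ≈⟨ +-congʳ (trans (+-assoc _ _ _) (+-congˡ (+-comm _ _))) ⟩
    (b * g + (- (a * g) + s)) - s    ≈⟨ trans (+-congʳ (sym (+-assoc _ _ _))) (+-assoc _ _ _) ⟩
    (b * g - a * g) + (s - s)        ≈⟨ trans (+-congˡ (-‿inverseʳ s)) (+-identityʳ _) ⟩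
    b * g - a * g                    ≈⟨ +-congˡ (-‿distribˡ-* a g) ⟩
    b * g + (- a) * g                ≈⟨ distribʳ g b (- a) ⟨
    (b - a) * g                      ∎

-- Coefficient lists as a commutative ring.

module Polynomials {c ℓ} (R : CommutativeRing c ℓ) where
  open CommutativeRing R
  open PolyOver R
  open import Algebra.Properties.Ring ring
  open import Algebra.Solver.Ring.NaturalCoefficients.Default commutativeSemiring
    using (solve; _:+_; _:*_; _:=_; con)
  open import Relation.Binary.Reasoning.Setoid setoid

  coeff : Poly → ℕ → Carrier
  coeff []      i       = 0#
  coeff (x ∷ p) zero    = x
  coeff (x ∷ p) (suc i) = coeff p i

  -- Comparing coefficients ignores trailing zeros. The record wrapper keeps the two lists visible
  -- to unification, which a bare family of equations between values of `coeff` would hide.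
  infix 4 _≋_
  record _≋_ (p q : Poly) : Set ℓ where
    constructor pointwise
    field at : ∀ i → coeff p i ≈ coeff q i
  open _≋_ public

  coeff-+ : ∀ p q i → coeff (p +P q) i ≈ coeff p i + coeff q i
  coeff-+ []      q       i       = sym (+-identityˡ _)
  coeff-+ (x ∷ p) []      i       = sym (+-identityʳ _)
  coeff-+ (x ∷ p) (y ∷ q) zero    = refl
  coeff-+ (x ∷ p) (y ∷ q) (suc i) = coeff-+ p q i

  coeff-scale : ∀ x p i → coeff (map (x *_) p) i ≈ x * coeff p i
  coeff-scale x []      i       = sym (zeroʳ x)
  coeff-scale x (y ∷ p) zero    = refl
  coeff-scale x (y ∷ p) (suc i) = coeff-scale x p i

  coeff-neg : ∀ p i → coeff (negP p) i ≈ - coeff p i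
  coeff-neg []      i       = sym -0#≈0#
  coeff-neg (y ∷ p) zero    = refl
  coeff-neg (y ∷ p) (suc i) = coeff-neg p i

  coeff-*-zero : ∀ x p q → coeff ((x ∷ p) *P q) 0 ≈ x * coeff q 0
  coeff-*-zero x p q = begin
    coeff ((x ∷ p) *P q) 0                 ≈⟨ coeff-+ (map (x *_) q) _ 0 ⟩
    coeff (map (x *_) q) 0 + 0#            ≈⟨ +-identityʳ _ ⟩
    coeff (map (x *_) q) 0                 ≈⟨ coeff-scale x q 0 ⟩
    x * coeff q 0                          ∎

  coeff-*-suc : ∀ x p q i →
    coeff ((x ∷ p) *P q) (suc i) ≈ x * coeff q (suc i) + coeff (p *P q) i
  coeff-*-suc x p q i =
    trans (coeff-+ (map (x *_) q) _ (suc i)) (+-congʳ (coeff-scale x q (suc i)))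

  ≋-refl : ∀ {p} → p ≋ p
  ≋-refl = pointwise λ _ → refl

  ≋-sym : ∀ {p q} → p ≋ q → q ≋ p
  ≋-sym e = pointwise λ i → sym (at e i)

  ≋-trans : ∀ {p q r} → p ≋ q → q ≋ r → p ≋ r
  ≋-trans e f = pointwise λ i → trans (at e i) (at f i)

  ≈P⇒≋ : ∀ {p q} → p ≈P q → p ≋ q
  ≈P⇒≋ {p} {q} e = pointwise λ i → x∙y⁻¹≈ε⇒x≈y _ _ (begin
    coeff p i + - coeff q i        ≈⟨ +-congˡ (coeff-neg q i) ⟨
    coeff p i + coeff (negP q) i   ≈⟨ coeff-+ p (negP q) i ⟨
    coeff (p +P negP q) i          ≈⟨ vanish e i ⟩
    0#                             ∎)
    where
    vanish : ∀ {r} → All (_≈ 0#) r → ∀ i → coeff r i ≈ 0#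
    vanish []       i       = refl
    vanish (z ∷ zs) zero    = z
    vanish (z ∷ zs) (suc i) = vanish zs i

  ∷-cong : ∀ {x y p q} → x ≈ y → p ≋ q → (x ∷ p) ≋ (y ∷ q)
  ∷-cong e f = pointwise λ { zero → e ; (suc i) → at f i }

  +P-cong : ∀ {p p′ q q′} → p ≋ p′ → q ≋ q′ → (p +P q) ≋ (p′ +P q′)
  +P-cong {p} {p′} {q} {q′} e f = pointwise λ i → begin
    coeff (p +P q) i         ≈⟨ coeff-+ p q i ⟩
    coeff p i + coeff q i    ≈⟨ +-cong (at e i) (at f i) ⟩
    coeff p′ i + coeff q′ i  ≈⟨ coeff-+ p′ q′ i ⟨
    coeff (p′ +P q′) i       ∎

  +P-assoc : ∀ p q r → ((p +P q) +P r) ≋ (p +P (q +P r))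
  +P-assoc p q r = pointwise λ i → begin
    coeff ((p +P q) +P r) i               ≈⟨ trans (coeff-+ (p +P q) r i) (+-congʳ (coeff-+ p q i)) ⟩
    (coeff p i + coeff q i) + coeff r i   ≈⟨ +-assoc _ _ _ ⟩
    coeff p i + (coeff q i + coeff r i)   ≈⟨ trans (coeff-+ p (q +P r) i) (+-congˡ (coeff-+ q r i)) ⟨
    coeff (p +P (q +P r)) i               ∎

  +P-comm : ∀ p q → (p +P q) ≋ (q +P p)
  +P-comm p q = pointwise λ i →
    trans (coeff-+ p q i) (trans (+-comm _ _) (sym (coeff-+ q p i)))

  +P-identityʳ : ∀ p → (p +P []) ≋ p
  +P-identityʳ p = pointwise λ i → trans (coeff-+ p [] i) (+-identityʳ _)

  negP-cong : ∀ {p q} → p ≋ q → negP p ≋ negP q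
  negP-cong {p} {q} e = pointwise λ i →
    trans (coeff-neg p i) (trans (-‿cong (at e i)) (sym (coeff-neg q i)))

  +P-inverseʳ : ∀ p → (p +P negP p) ≋ []
  +P-inverseʳ p = pointwise λ i →
    trans (coeff-+ p (negP p) i) (trans (+-congˡ (coeff-neg p i)) (-‿inverseʳ _))

  *P-congˡ : ∀ p {q r} → q ≋ r → (p *P q) ≋ (p *P r)
  *P-congˡ []      e = ≋-refl
  *P-congˡ (x ∷ p) {q} {r} e = +P-cong
    (pointwise λ i → trans (coeff-scale x q i) (trans (*-congˡ (at e i)) (sym (coeff-scale x r i))))
    (∷-cong refl (*P-congˡ p e))

  *P-zeroʳ : ∀ p → (p *P []) ≋ []
  *P-zeroʳ []      = ≋-refl
  *P-zeroʳ (x ∷ p) = pointwise λ { zero → refl ; (suc i) → at (*P-zeroʳ p) i }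

  -- The product recurses on its left factor; this is the mirror recursion on the right factor, from
  -- which commutativity follows.
  *P-∷ : ∀ p y q → (p *P (y ∷ q)) ≋ (map (y *_) p +P (0# ∷ (p *P q)))
  *P-∷ []      y q = pointwise λ { zero → refl ; (suc i) → refl }
  *P-∷ (x ∷ p) y q = pointwise λ
    { zero    → +-congʳ (*-comm x y)
    ; (suc i) → begin
        coeff ((x ∷ p) *P (y ∷ q)) (suc i)
          ≈⟨ coeff-*-suc x p (y ∷ q) i ⟩
        x * coeff q i + coeff (p *P (y ∷ q)) i
          ≈⟨ +-congˡ (trans (at (*P-∷ p y q) i) (coeff-+ (map (y *_) p) _ i)) ⟩
        x * coeff q i + (coeff (map (y *_) p) i + coeff (0# ∷ (p *P q)) i)
          ≈⟨ solve 3 (λ a b d → a :+ (b :+ d) := b :+ (a :+ d)) refl _ _ _ ⟩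
        coeff (map (y *_) p) i + (x * coeff q i + coeff (0# ∷ (p *P q)) i)
          ≈⟨ +-congˡ (trans (coeff-+ (map (x *_) q) _ i) (+-congʳ (coeff-scale x q i))) ⟨
        coeff (map (y *_) p) i + coeff ((x ∷ p) *P q) i
          ≈⟨ coeff-+ (map (y *_) p) _ i ⟨
        coeff (map (y *_) p +P ((x ∷ p) *P q)) i
          ∎ }

  *P-comm : ∀ p q → (p *P q) ≋ (q *P p)
  *P-comm []      q = ≋-sym (*P-zeroʳ q)
  *P-comm (x ∷ p) q =
    ≋-trans (+P-cong ≋-refl (∷-cong refl (*P-comm p q))) (≋-sym (*P-∷ q x p))

  *P-congʳ : ∀ q {p p′} → p ≋ p′ → (p *P q) ≋ (p′ *P q)
  *P-congʳ q {p} {p′} e = ≋-trans (*P-comm p q) (≋-trans (*P-congˡ q e) (*P-comm q p′))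

  +P-congˡ : ∀ p {q q′} → q ≋ q′ → (p +P q) ≋ (p +P q′)
  +P-congˡ p = +P-cong {p} {p} ≋-refl

  *P-cong : ∀ {p p′ q q′} → p ≋ p′ → q ≋ q′ → (p *P q) ≋ (p′ *P q′)
  *P-cong {p} {p′} {q} {q′} e f = ≋-trans (*P-congˡ p f) (*P-congʳ q′ e)

  *P-identityˡ : ∀ p → (oneP *P p) ≋ p
  *P-identityˡ p = pointwise λ
    { zero    → trans (coeff-*-zero 1# [] p) (*-identityˡ _)
    ; (suc i) → trans (coeff-*-suc 1# [] p i) (trans (+-identityʳ _) (*-identityˡ _)) }

  *P-distribʳ : ∀ r p q → ((p +P q) *P r) ≋ ((p *P r) +P (q *P r))
  *P-distribʳ r []      q       = ≋-refl
  *P-distribʳ r (x ∷ p) []      = ≋-sym (+P-identityʳ _)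
  *P-distribʳ r (x ∷ p) (y ∷ q) = pointwise λ
    { zero → begin
        coeff (((x ∷ p) +P (y ∷ q)) *P r) 0   ≈⟨ coeff-*-zero (x + y) (p +P q) r ⟩
        (x + y) * coeff r 0                   ≈⟨ distribʳ _ _ _ ⟩
        x * coeff r 0 + y * coeff r 0         ≈⟨ +-cong (coeff-*-zero x p r) (coeff-*-zero y q r) ⟨
        coeff ((x ∷ p) *P r) 0 + coeff ((y ∷ q) *P r) 0
                                              ≈⟨ coeff-+ ((x ∷ p) *P r) _ 0 ⟨
        coeff (((x ∷ p) *P r) +P ((y ∷ q) *P r)) 0 ∎
    ; (suc i) → begin
        coeff (((x ∷ p) +P (y ∷ q)) *P r) (suc i)
          ≈⟨ coeff-*-suc (x + y) (p +P q) r i ⟩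
        (x + y) * coeff r (suc i) + coeff ((p +P q) *P r) i
          ≈⟨ +-congˡ (trans (at (*P-distribʳ r p q) i) (coeff-+ (p *P r) _ i)) ⟩
        (x + y) * coeff r (suc i) + (coeff (p *P r) i + coeff (q *P r) i)
          ≈⟨ solve 5 (λ x y z a b →
               (x :+ y) :* z :+ (a :+ b) := (x :* z :+ a) :+ (y :* z :+ b)) refl _ _ _ _ _ ⟩
        (x * coeff r (suc i) + coeff (p *P r) i) + (y * coeff r (suc i) + coeff (q *P r) i)
          ≈⟨ +-cong (coeff-*-suc x p r i) (coeff-*-suc y q r i) ⟨
        coeff ((x ∷ p) *P r) (suc i) + coeff ((y ∷ q) *P r) (suc i)
          ≈⟨ coeff-+ ((x ∷ p) *P r) _ (suc i) ⟨
        coeff (((x ∷ p) *P r) +P ((y ∷ q) *P r)) (suc i) ∎ }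

  scale-*P : ∀ x p q → (map (x *_) p *P q) ≋ map (x *_) (p *P q)
  scale-*P x []      q = ≋-refl
  scale-*P x (y ∷ p) q = pointwise λ
    { zero → begin
        coeff ((x * y ∷ map (x *_) p) *P q) 0  ≈⟨ coeff-*-zero (x * y) (map (x *_) p) q ⟩
        (x * y) * coeff q 0                    ≈⟨ *-assoc _ _ _ ⟩
        x * (y * coeff q 0)                    ≈⟨ *-congˡ (coeff-*-zero y p q) ⟨
        x * coeff ((y ∷ p) *P q) 0             ≈⟨ coeff-scale x ((y ∷ p) *P q) 0 ⟨
        coeff (map (x *_) ((y ∷ p) *P q)) 0    ∎
    ; (suc i) → begin
        coeff ((x * y ∷ map (x *_) p) *P q) (suc i)
          ≈⟨ coeff-*-suc (x * y) (map (x *_) p) q i ⟩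
        (x * y) * coeff q (suc i) + coeff (map (x *_) p *P q) i
          ≈⟨ +-congˡ (trans (at (scale-*P x p q) i) (coeff-scale x (p *P q) i)) ⟩
        (x * y) * coeff q (suc i) + x * coeff (p *P q) i
          ≈⟨ solve 4 (λ x y z a → (x :* y) :* z :+ x :* a := x :* (y :* z :+ a)) refl _ _ _ _ ⟩
        x * (y * coeff q (suc i) + coeff (p *P q) i)
          ≈⟨ *-congˡ (coeff-*-suc y p q i) ⟨
        x * coeff ((y ∷ p) *P q) (suc i)
          ≈⟨ coeff-scale x ((y ∷ p) *P q) (suc i) ⟨
        coeff (map (x *_) ((y ∷ p) *P q)) (suc i) ∎ }

  0∷-*P : ∀ p q → ((0# ∷ p) *P q) ≋ (0# ∷ (p *P q))
  0∷-*P p q = pointwise λ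
    { zero    → trans (coeff-*-zero 0# p q) (zeroˡ _)
    ; (suc i) → trans (coeff-*-suc 0# p q i) (trans (+-congʳ (zeroˡ _)) (+-identityˡ _)) }

  *P-assoc : ∀ p q r → ((p *P q) *P r) ≋ (p *P (q *P r))
  *P-assoc []      q r = ≋-refl
  *P-assoc (x ∷ p) q r =
    ≋-trans (*P-distribʳ r (map (x *_) q) (0# ∷ (p *P q)))
      (+P-cong (scale-*P x q r)
        (≋-trans (0∷-*P (p *P q) r) (∷-cong refl (*P-assoc p q r))))

  polyRing : CommutativeRing c ℓ
  polyRing = record
    { Carrier = Poly ; _≈_ = _≋_ ; _+_ = _+P_ ; _*_ = _*P_ ; -_ = negP ; 0# = [] ; 1# = oneP
    ; isCommutativeRing = record
      { isRing = record
        { +-isAbelianGroup = record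
          { isGroup = record
            { isMonoid = record
              { isSemigroup = record
                { isMagma = record
                  { isEquivalence = record { refl = ≋-refl ; sym = ≋-sym ; trans = ≋-trans }
                  ; ∙-cong = +P-cong }
                ; assoc = +P-assoc }
              ; identity = (λ _ → ≋-refl) , +P-identityʳ }
            ; inverse = (λ p → ≋-trans (+P-comm (negP p) p) (+P-inverseʳ p)) , +P-inverseʳ
            ; ⁻¹-cong = negP-cong }
          ; comm = +P-comm }
        ; *-cong = *P-cong
        ; *-assoc = *P-assoc
        ; *-identity = *P-identityˡ , λ p → ≋-trans (*P-comm p oneP) (*P-identityˡ p)
        ; distrib = (λ p q r → ≋-trans (*P-comm p (q +P r))
                      (≋-trans (*P-distribʳ p q r) (+P-cong (*P-comm q p) (*P-comm r p))))
                  , *P-distribʳ }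
      ; *-comm = *P-comm } }

  X-*P : ∀ p → (X *P p) ≋ (0# ∷ p)
  X-*P p = ≋-trans (0∷-*P oneP p) (∷-cong refl (*P-identityˡ p))

  -- Evaluation and formal derivative.

  eval : Poly → Carrier → Carrier
  eval []      γ = 0#
  eval (x ∷ p) γ = x + γ * eval p γ

  eval-cong : ∀ {p q} → p ≋ q → ∀ γ → eval p γ ≈ eval q γ
  eval-cong {[]}    {q}     e γ = sym (eval-zero q (≋-sym e))
    where
    eval-zero : ∀ p → p ≋ [] → eval p γ ≈ 0#
    eval-zero []      e = refl
    eval-zero (x ∷ p) e = begin
      x + γ * eval p γ  ≈⟨ +-cong (at e 0) (*-congˡ (eval-zero p (pointwise (at e ∘ suc)))) ⟩
      0# + γ * 0#       ≈⟨ trans (+-identityˡ _) (zeroʳ γ) ⟩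
      0#                ∎
  eval-cong {x ∷ p} {[]}    e γ = sym (eval-cong (≋-sym e) γ)
  eval-cong {x ∷ p} {y ∷ q} e γ =
    +-cong (at e 0) (*-congˡ (eval-cong {p} {q} (pointwise (at e ∘ suc)) γ))

  eval-+ : ∀ p q γ → eval (p +P q) γ ≈ eval p γ + eval q γ
  eval-+ []      q       γ = sym (+-identityˡ _)
  eval-+ (x ∷ p) []      γ = sym (+-identityʳ _)
  eval-+ (x ∷ p) (y ∷ q) γ = begin
    (x + y) + γ * eval (p +P q) γ
      ≈⟨ +-congˡ (*-congˡ (eval-+ p q γ)) ⟩
    (x + y) + γ * (eval p γ + eval q γ)
      ≈⟨ solve 5 (λ x y g a b →
           (x :+ y) :+ g :* (a :+ b) := (x :+ g :* a) :+ (y :+ g :* b)) refl _ _ _ _ _ ⟩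
    (x + γ * eval p γ) + (y + γ * eval q γ) ∎

  eval-scale : ∀ x p γ → eval (map (x *_) p) γ ≈ x * eval p γ
  eval-scale x []      γ = sym (zeroʳ x)
  eval-scale x (y ∷ p) γ = trans (+-congˡ (*-congˡ (eval-scale x p γ)))
    (solve 4 (λ x y g a → x :* y :+ g :* (x :* a) := x :* (y :+ g :* a)) refl _ _ _ _)

  eval-* : ∀ p q γ → eval (p *P q) γ ≈ eval p γ * eval q γ
  eval-* []      q γ = sym (zeroˡ _)
  eval-* (x ∷ p) q γ = begin
    eval (map (x *_) q +P (0# ∷ (p *P q))) γ
      ≈⟨ eval-+ (map (x *_) q) _ γ ⟩
    eval (map (x *_) q) γ + (0# + γ * eval (p *P q) γ)
      ≈⟨ +-cong (eval-scale x q γ) (trans (+-identityˡ _) (*-congˡ (eval-* p q γ))) ⟩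
    x * eval q γ + γ * (eval p γ * eval q γ)
      ≈⟨ solve 4 (λ x g a b → x :* b :+ g :* (a :* b) := (x :+ g :* a) :* b) refl _ _ _ _ ⟩
    (x + γ * eval p γ) * eval q γ ∎

  eval-X : ∀ γ → eval X γ ≈ γ
  eval-X = solve 1 (λ g → con 0 :+ g :* (con 1 :+ g :* con 0) := g) refl

  -- The product rule for x + X·p, so that no exponent has to be carried along the list.
  deriv : Poly → Poly
  deriv []      = []
  deriv (x ∷ p) = p +P (0# ∷ deriv p)

  coeff-deriv : ∀ p i → coeff (deriv p) i ≈ natR (suc i) * coeff p (suc i)
  coeff-deriv []      i       = sym (zeroʳ _)
  coeff-deriv (x ∷ p) zero    = trans (coeff-+ p _ 0)
    (solve 1 (λ a → a :+ con 0 := (con 1 :+ con 0) :* a) refl _)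
  coeff-deriv (x ∷ p) (suc i) = begin
    coeff (p +P (0# ∷ deriv p)) (suc i)                    ≈⟨ coeff-+ p _ (suc i) ⟩
    coeff p (suc i) + coeff (deriv p) i                    ≈⟨ +-congˡ (coeff-deriv p i) ⟩
    coeff p (suc i) + natR (suc i) * coeff p (suc i)
      ≈⟨ solve 2 (λ a n → a :+ n :* a := (con 1 :+ n) :* a) refl _ _ ⟩
    (1# + natR (suc i)) * coeff p (suc i)                  ∎

  deriv-cong : ∀ {p q} → p ≋ q → deriv p ≋ deriv q
  deriv-cong {p} {q} e = pointwise λ i →
    trans (coeff-deriv p i) (trans (*-congˡ (at e (suc i))) (sym (coeff-deriv q i)))

  deriv-+ : ∀ p q → deriv (p +P q) ≋ (deriv p +P deriv q)
  deriv-+ p q = pointwise λ i → begin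
    coeff (deriv (p +P q)) i
      ≈⟨ coeff-deriv (p +P q) i ⟩
    natR (suc i) * coeff (p +P q) (suc i)
      ≈⟨ trans (*-congˡ (coeff-+ p q (suc i))) (distribˡ _ _ _) ⟩
    natR (suc i) * coeff p (suc i) + natR (suc i) * coeff q (suc i)
      ≈⟨ +-cong (coeff-deriv p i) (coeff-deriv q i) ⟨
    coeff (deriv p) i + coeff (deriv q) i
      ≈⟨ coeff-+ (deriv p) (deriv q) i ⟨
    coeff (deriv p +P deriv q) i ∎

  deriv-scale : ∀ x p → deriv (map (x *_) p) ≋ map (x *_) (deriv p)
  deriv-scale x p = pointwise λ i → begin
    coeff (deriv (map (x *_) p)) i
      ≈⟨ trans (coeff-deriv (map (x *_) p) i) (*-congˡ (coeff-scale x p (suc i))) ⟩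
    natR (suc i) * (x * coeff p (suc i))
      ≈⟨ solve 3 (λ n x a → n :* (x :* a) := x :* (n :* a)) refl _ _ _ ⟩
    x * (natR (suc i) * coeff p (suc i))
      ≈⟨ trans (coeff-scale x (deriv p) i) (*-congˡ (coeff-deriv p i)) ⟨
    coeff (map (x *_) (deriv p)) i ∎

  deriv-X : deriv X ≋ oneP
  deriv-X = pointwise λ { zero → +-identityʳ _ ; (suc zero) → refl ; (suc (suc i)) → refl }

  -- Degrees and leading coefficients.

  natR-+ : ∀ m n → natR (m ℕ.+ n) ≈ natR m + natR n
  natR-+ zero    n = sym (+-identityˡ _)
  natR-+ (suc m) n = trans (+-congˡ (natR-+ m n)) (sym (+-assoc _ _ _))

  -- The coefficient `t` may be zero, and then `n` merely bounds the degree. Degrees are handled in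
  -- this way without deciding which coefficients vanish.
  record Leads (n : ℕ) (t : Carrier) (p : Poly) : Set ℓ where
    field
      lead  : coeff p n ≈ t
      above : ∀ {i} → n < i → coeff p i ≈ 0#
  open Leads public

  leads-resp : ∀ {m n s t p q} → m ≡ n → s ≈ t → p ≋ q → Leads m s p → Leads n t q
  leads-resp ≡.refl e f l = record
    { lead  = trans (sym (at f _)) (trans (lead l) e)
    ; above = λ n<i → trans (sym (at f _)) (above l n<i) }

  leads-+ : ∀ {n s t p q} → Leads n s p → Leads n t q → Leads n (s + t) (p +P q)
  leads-+ {p = p} {q} k l = record
    { lead  = trans (coeff-+ p q _) (+-cong (lead k) (lead l))
    ; above = λ n<i → trans (coeff-+ p q _)
        (trans (+-cong (above k n<i) (above l n<i)) (+-identityˡ _)) }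

  leads-neg : ∀ {n t p} → Leads n t p → Leads n (- t) (negP p)
  leads-neg {p = p} l = record
    { lead  = trans (coeff-neg p _) (-‿cong (lead l))
    ; above = λ n<i → trans (coeff-neg p _) (trans (-‿cong (above l n<i)) -0#≈0#) }

  leads-raise : ∀ {m n t p} → m < n → Leads m t p → Leads n 0# p
  leads-raise m<n l = record { lead = above l m<n ; above = λ n<i → above l (ℕ.<-trans m<n n<i) }

  leads-zero : ∀ n → Leads n 0# []
  leads-zero n = record { lead = refl ; above = λ _ → refl }

  leads-∷ : ∀ {n t p} x → Leads n t p → Leads (suc n) t (x ∷ p)
  leads-∷ x l = record { lead = lead l ; above = λ { (s≤s n<i) → above l n<i } }

  leads-scale : ∀ {n t p} x → Leads n t p → Leads n (x * t) (map (x *_) p)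
  leads-scale {p = p} x l = record
    { lead  = trans (coeff-scale x p _) (*-congˡ (lead l))
    ; above = λ n<i → trans (coeff-scale x p _) (trans (*-congˡ (above l n<i)) (zeroʳ x)) }

  leads-* : ∀ {m n s t p q} → Leads m s p → Leads n t q → Leads (m ℕ.+ n) (s * t) (p *P q)
  leads-* {p = []} k l =
    leads-resp ≡.refl (trans (sym (zeroˡ _)) (*-congʳ (lead k))) ≋-refl (leads-zero _)
  leads-* {m = zero} {n} {p = x ∷ p} {q} k l =
    leads-resp ≡.refl (trans (+-identityʳ _) (*-congʳ (lead k))) ≋-refl
      (leads-+ (leads-scale x l)
        (leads-resp ≡.refl refl (≋-sym 0∷pq≋0) (leads-zero n)))
    where
    0∷pq≋0 : (0# ∷ (p *P q)) ≋ []
    0∷pq≋0 = ≋-trans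
      (∷-cong refl (*P-congʳ q {p} {[]} (pointwise λ i → above k (s≤s z≤n))))
      (pointwise λ { zero → refl ; (suc i) → refl })
  leads-* {m = suc m} {n} {p = x ∷ p} k l =
    leads-resp ≡.refl (+-identityˡ _) ≋-refl
      (leads-+ (leads-raise (s≤s (ℕ.m≤n+m n m)) (leads-scale x l))
        (leads-∷ 0# (leads-* {p = p} (record { lead = lead k ; above = λ m<i → above k (s≤s m<i) }) l)))

  -- X·p′ multiplies the coefficient of degree i by i, for i = 0 too. The shift avoids the degree n
  -- - 1.
  leads-0∷deriv : ∀ {n t p} → Leads n t p → Leads n (natR n * t) (0# ∷ deriv p)
  leads-0∷deriv {p = p} l = record
    { lead  = trans (coeff-0∷deriv _) (*-congˡ (lead l))
    ; above = λ n<i → trans (coeff-0∷deriv _) (trans (*-congˡ (above l n<i)) (zeroʳ _)) }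
    where
    coeff-0∷deriv : ∀ i → coeff (0# ∷ deriv p) i ≈ natR i * coeff p i
    coeff-0∷deriv zero    = sym (zeroˡ _)
    coeff-0∷deriv (suc i) = coeff-deriv p i

  -- In degrees above `d` the head `x` contributes nothing, because `g` stops at `d`; so the tail
  -- times `g` vanishes from degree `d` on. By induction the tail is constant, and as `g` is monic
  -- this constant is the coefficient of degree `d` of that product, which is zero.
  multiple-small : ∀ w {g d} → Leads d 1# g →
    (∀ {i} → d < i → coeff (w *P g) i ≈ 0#) → ∀ i → coeff w (suc i) ≈ 0#
  multiple-small []      l small i = refl
  multiple-small (x ∷ w) {g} {d} l small = w≋0
    where
    shifted : ∀ {i} → d ≤ i → coeff (w *P g) i ≈ 0#
    shifted {i} d≤i = begin
      coeff (w *P g) i                        ≈⟨ +-identityˡ _ ⟨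
      0# + coeff (w *P g) i                   ≈⟨ +-congʳ (trans (*-congˡ (above l (s≤s d≤i))) (zeroʳ x)) ⟨
      x * coeff g (suc i) + coeff (w *P g) i  ≈⟨ coeff-*-suc x w g i ⟨
      coeff ((x ∷ w) *P g) (suc i)            ≈⟨ small (s≤s d≤i) ⟩
      0#                                      ∎

    w-constant : ∀ i → coeff w (suc i) ≈ 0#
    w-constant = multiple-small w l (λ d<i → shifted (ℕ.<⇒≤ d<i))

    w≋0 : ∀ i → coeff w i ≈ 0#
    w≋0 zero    = begin
      coeff w 0         ≈⟨ *-identityʳ _ ⟨
      coeff w 0 * 1#    ≈⟨ lead (leads-* {m = 0} {p = w}
                                       (record { lead = refl ; above = λ { {suc i} _ → w-constant i } }) l) ⟨
      coeff (w *P g) d  ≈⟨ shifted ℕ.≤-refl ⟩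
      0#                ∎
    w≋0 (suc i) = w-constant i

  leads-degree : ¬ (1# ≈ 0#) → ∀ {m n p} → Leads m 1# p → Leads n 1# p → m ≡ n
  leads-degree 1≉0 {m} {n} k l with ℕ.<-cmp m n
  ... | tri< m<n _ _ = contradiction (trans (sym (lead l)) (above k m<n)) 1≉0
  ... | tri≈ _ m≡n _ = m≡n
  ... | tri> _ _ n<m = contradiction (trans (sym (lead k)) (above l n<m)) 1≉0

-- Traces modulo a monic polynomial.

module Traces {c ℓ} (R : CommutativeRing c ℓ) where
  open CommutativeRing R
  open PolyOver R
  open Polynomials R
  open import Algebra.Properties.Ring ring

  module P = CommutativeRing polyRing
  module P-Ring = Algebra.Properties.Ring P.ring
  open Rearrangement polyRing
  open import Algebra.Solver.Ring.NaturalCoefficients.Default P.commutativeSemiring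
    using (solve; _:+_; _:*_; _:=_; con)
  open import Relation.Binary.Reasoning.Setoid P.setoid

  deriv-* : ∀ p q → deriv (p *P q) ≋ (deriv p *P q +P p *P deriv q)
  deriv-* []      q = ≋-refl
  deriv-* (x ∷ p) q = begin
    deriv (map (x *_) q +P (0# ∷ (p *P q)))
      ≈⟨ deriv-+ (map (x *_) q) _ ⟩
    deriv (map (x *_) q) +P (p *P q +P (0# ∷ deriv (p *P q)))
      ≈⟨ +P-cong (deriv-scale x q) (+P-cong ≋-refl
           (≋-trans (≋-sym (X-*P _)) (*P-congˡ X (deriv-* p q)))) ⟩
    map (x *_) (deriv q) +P (p *P q +P X *P (deriv p *P q +P p *P deriv q))
      ≈⟨ solve 6 (λ s X p p′ q q′ →
           s :+ (p :* q :+ X :* (p′ :* q :+ p :* q′)) :=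
           (p :+ X :* p′) :* q :+ (s :+ X :* (p :* q′)))
           ≋-refl (map (x *_) (deriv q)) X p (deriv p) q (deriv q) ⟩
    (p +P X *P deriv p) *P q +P (map (x *_) (deriv q) +P X *P (p *P deriv q))
      ≈⟨ +P-cong (*P-congʳ q (+P-congˡ p (X-*P (deriv p))))
           (+P-congˡ (map (x *_) (deriv q)) (X-*P (p *P deriv q))) ⟩
    deriv (x ∷ p) *P q +P (x ∷ p) *P deriv q ∎

  -- Trace f g d t holds when g is monic of degree d and t is the sum of f over
  -- the roots of g in a splitting extension, which is read off as the
  -- coefficient of degree d − 1 of f·g′ modulo g; the remainder is shifted by
  -- one degree so that d = 0 needs no exception.
  record Trace (f g : Poly) (d : ℕ) (t : Carrier) : Set (c ⊔ ℓ) where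
    field
      monic     : Leads d 1# g
      quot rem  : Poly
      division  : f *P deriv g ≋ quot *P g +P rem
      trace     : Leads d t (0# ∷ rem)

  trace-resp : ∀ {f g h d s t} → g ≋ h → s ≈ t → Trace f g d s → Trace f h d t
  trace-resp {f} e s≈t T = record
    { monic    = leads-resp ≡.refl refl e monic
    ; quot     = quot
    ; rem      = rem
    ; division = ≋-trans (*P-congˡ f (deriv-cong (≋-sym e)))
                   (≋-trans division (+P-cong (*P-congˡ quot e) ≋-refl))
    ; trace    = leads-resp ≡.refl s≈t ≋-refl trace }
    where open Trace T

  trace-one : ∀ f → Trace f oneP 0 0#
  trace-one f = record
    { monic    = record { lead = refl ; above = λ { (s≤s _) → refl } }
    ; quot     = []
    ; rem      = []
    ; division = ≋-trans (*P-congˡ f (pointwise λ { zero → refl ; (suc i) → refl })) (*P-zeroʳ f)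
    ; trace    = record { lead = refl ; above = λ { (s≤s _) → refl } } }

  -- By the product rule f(gh)′ = (fg′)h + g(fh′), so remainders r of fg′ and v of fh′ combine to rh
  -- + gv. This is already small enough to be the new remainder, and since `g` and `h` are monic its
  -- top coefficient is s + t.
  trace-* : ∀ {f g h d e s t} →
    Trace f g d s → Trace f h e t → Trace f (g *P h) (d ℕ.+ e) (s + t)
  trace-* {f} {g} {h} S T = record
    { monic    = leads-resp ≡.refl (*-identityˡ _) ≋-refl (leads-* S.monic T.monic)
    ; quot     = S.quot +P T.quot
    ; rem      = S.rem *P h +P g *P T.rem
    ; division = begin
        f *P deriv (g *P h)
          ≈⟨ *P-congˡ f (deriv-* g h) ⟩
        f *P (deriv g *P h +P g *P deriv h)
          ≈⟨ solve 5 (λ f g g′ h h′ →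
               f :* (g′ :* h :+ g :* h′) := (f :* g′) :* h :+ g :* (f :* h′))
               ≋-refl f g (deriv g) h (deriv h) ⟩
        (f *P deriv g) *P h +P g *P (f *P deriv h)
          ≈⟨ +P-cong (*P-cong S.division ≋-refl) (*P-congˡ g T.division) ⟩
        (S.quot *P g +P S.rem) *P h +P g *P (T.quot *P h +P T.rem)
          ≈⟨ solve 6 (λ g h q r u v →
               (q :* g :+ r) :* h :+ g :* (u :* h :+ v) :=
               (q :+ u) :* (g :* h) :+ (r :* h :+ g :* v))
               ≋-refl g h S.quot S.rem T.quot T.rem ⟩
        (S.quot +P T.quot) *P (g *P h) +P (S.rem *P h +P g *P T.rem) ∎
    ; trace    = leads-resp ≡.refl (+-cong (*-identityʳ _) (*-identityˡ _)) shift
        (leads-+ (leads-* S.trace T.monic) (leads-* S.monic T.trace)) }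
    where
    module S = Trace S
    module T = Trace T
    shift : ((0# ∷ S.rem) *P h +P g *P (0# ∷ T.rem)) ≋ (0# ∷ (S.rem *P h +P g *P T.rem))
    shift = begin
      (0# ∷ S.rem) *P h +P g *P (0# ∷ T.rem)
        ≈⟨ +P-cong (*P-cong (X-*P S.rem) ≋-refl) (*P-congˡ g (X-*P T.rem)) ⟨
      (X *P S.rem) *P h +P g *P (X *P T.rem)
        ≈⟨ solve 5 (λ X g h r v → (X :* r) :* h :+ g :* (X :* v) := X :* (r :* h :+ g :* v))
             ≋-refl X g h S.rem T.rem ⟩
      X *P (S.rem *P h +P g *P T.rem)
        ≈⟨ X-*P _ ⟩
      0# ∷ (S.rem *P h +P g *P T.rem) ∎

  trace-multiple : ∀ {f g d} u → Leads d 1# g → f ≋ u *P g → Trace f g d 0#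
  trace-multiple {f} {g} u l e = record
    { monic    = l
    ; quot     = u *P deriv g
    ; rem      = []
    ; division = ≋-trans (*P-cong e ≋-refl) (≋-trans
          (solve 3 (λ u g g′ → (u :* g) :* g′ := (u :* g′) :* g) ≋-refl u g (deriv g))
          (≋-sym (+P-identityʳ _)))
    ; trace    = leads-resp ≡.refl refl (pointwise λ { zero → refl ; (suc i) → refl })
                   (leads-zero _) }

  linear : Carrier → Poly
  linear γ = X +P constP (- γ)

  -- Horner's scheme: the value of the tail at `γ` becomes the constant term of the next quotient.
  horner : ∀ f γ → ∃ λ q → f ≋ q *P linear γ +P constP (eval f γ)
  horner []      γ = [] , pointwise λ { zero → refl ; (suc i) → refl }
  horner (x ∷ f) γ with horner f γ
  ... | q , e = X *P q +P constP v , (begin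
    x ∷ f
      ≈⟨ ∷-cong (+-identityʳ x) ≋-refl ⟨
    constP x +P (0# ∷ f)
      ≈⟨ +P-congˡ (constP x) (≋-trans (≋-sym (X-*P f)) (*P-congˡ X e)) ⟩
    constP x +P X *P (q *P linear γ +P constP v)
      ≈⟨ solve 5 (λ x X q L v → x :+ X :* (q :* L :+ v) := (X :* q) :* L :+ (x :+ X :* v))
           ≋-refl (constP x) X q (linear γ) (constP v) ⟩
    (X *P q) *P linear γ +P (constP x +P X *P constP v)
      ≈⟨ +P-congˡ _ (+P-congˡ (constP x) (*P-congʳ (constP v) X≋)) ⟩
    (X *P q) *P linear γ +P (constP x +P (linear γ +P constP γ) *P constP v)
      ≈⟨ solve 6 (λ x X q L v g →
           (X :* q) :* L :+ (x :+ (L :+ g) :* v) := (X :* q :+ v) :* L :+ (x :+ g :* v))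
           ≋-refl (constP x) X q (linear γ) (constP v) (constP γ) ⟩
    (X *P q +P constP v) *P linear γ +P (constP x +P constP γ *P constP v)
      ≈⟨ +P-congˡ _ (∷-cong (+-congˡ (+-identityʳ _)) ≋-refl) ⟩
    (X *P q +P constP v) *P linear γ +P constP (x + γ * v) ∎)
    where
    v = eval f γ
    X≋ : X ≋ linear γ +P constP γ
    X≋ = pointwise λ
      { zero → sym (trans (+-assoc _ _ _) (trans (+-identityˡ _) (-‿inverseˡ γ)))
      ; (suc zero) → refl ; (suc (suc i)) → refl }

  -- The derivative of X - γ is 1, so the trace is the remainder of `f` itself. Multiplied up over
  -- linear factors, this ties traces to the sums over roots in the theorem.
  trace-linear : ∀ f γ → Trace f (linear γ) 1 (eval f γ)
  trace-linear f γ = record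
    { monic    = record { lead = refl ; above = λ { {suc (suc i)} _ → refl ; {suc zero} (s≤s ()) } }
    ; quot     = proj₁ (horner f γ)
    ; rem      = constP (eval f γ)
    ; division = ≋-trans (*P-congˡ f (pointwise λ
                   { zero → +-identityʳ 1# ; (suc zero) → refl ; (suc (suc i)) → refl }))
                   (≋-trans (proj₂ P.*-identity f) (proj₂ (horner f γ)))
    ; trace    = record { lead = refl ; above = λ { {suc (suc i)} _ → refl ; {suc zero} (s≤s ()) } } }

  trace-rootsPoly : ∀ f γs → Trace f (rootsPoly γs) (length γs) (sumR (map (eval f) γs))
  trace-rootsPoly f []       = trace-one f
  trace-rootsPoly f (γ ∷ γs) = trace-* (trace-linear f γ) (trace-rootsPoly f γs)

  -- The shifted remainders differ by a multiple w·g of degree at most `d`, so w is constant. The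
  -- shift makes w a multiple of X, so this constant is zero, and hence s = t. Nontriviality of `R`
  -- forces the two degrees to agree beforehand.
  trace-unique : ¬ (1# ≈ 0#) → ∀ {f g d e s t} → Trace f g d s → Trace f g e t → s ≈ t
  trace-unique 1≉0 {f} {g} {d} {e} {s} {t} S T
    with leads-degree 1≉0 (Trace.monic S) (Trace.monic T)
  ... | ≡.refl = x∙y⁻¹≈ε⇒x≈y s t
    (trans (sym (lead difference)) (at (*P-congʳ g w≋0) d))
    where
    module S = Trace S
    module T = Trace T
    w = 0# ∷ (T.quot +P negP S.quot)

    difference : Leads d (s - t) (w *P g)
    difference = leads-resp ≡.refl refl
      (begin
        (0# ∷ S.rem) +P negP (0# ∷ T.rem)
          ≈⟨ +P-cong (X-*P S.rem) (≋-trans (≋-sym (P-Ring.-‿distribʳ-* X T.rem)) (P.-‿cong (X-*P T.rem))) ⟨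
        X *P S.rem +P X *P negP T.rem
          ≈⟨ ≋-sym (proj₁ P.distrib X S.rem (negP T.rem)) ⟩
        X *P (S.rem +P negP T.rem)
          ≈⟨ *P-congˡ X (cross {S.quot} {T.quot} {g} {S.rem} {T.rem} (≋-trans (≋-sym S.division) T.division)) ⟩
        X *P ((T.quot +P negP S.quot) *P g)
          ≈⟨ ≋-sym (*P-assoc X (T.quot +P negP S.quot) g) ⟩
        (X *P (T.quot +P negP S.quot)) *P g
          ≈⟨ *P-congʳ g (X-*P (T.quot +P negP S.quot)) ⟩
        w *P g ∎)
      (leads-+ S.trace (leads-neg T.trace))

    w≋0 : w ≋ []
    w≋0 = pointwise λ
      { zero → refl ; (suc i) → multiple-small w S.monic (above difference) i }

  trace-respˡ : ∀ {f f′ g d t} → f ≋ f′ → Trace f g d t → Trace f′ g d t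
  trace-respˡ {g = g} e T = record
    { monic    = Trace.monic T
    ; quot     = Trace.quot T
    ; rem      = Trace.rem T
    ; division = ≋-trans (*P-congʳ (deriv g) (≋-sym e)) (Trace.division T)
    ; trace    = Trace.trace T }

  leads-X : Leads 1 1# X
  leads-X = record { lead = refl ; above = λ { {suc (suc i)} _ → refl ; {suc zero} (s≤s ()) } }

  -- With N = b² + X + e and e g = h b one has
  --   g (b² + X) N′ ≡ 2 h b′ (X + e) − h b (1 + e′)  (mod N),
  -- and both terms on the right have degree deg N − 1.
  trace-iterate : ∀ {b e g h B E H} →
    Leads B 1# b → Leads E 1# e → Leads H 1# h → H ℕ.+ E ≡ B → 2 ≤ E → e *P g ≋ h *P b →
    Trace (g *P (b *P b +P X)) ((b *P b +P X) +P e) (B ℕ.+ B) (natR (B ℕ.+ B) - natR E)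
  trace-iterate {b} {e} {g} {h} {B} {E} {H} lb le lh H+E≡B 2≤E eg≋hb = record
    { monic    = leads-resp ≡.refl
        (trans (+-identityʳ _) (trans (+-identityʳ _) (*-identityˡ 1#))) ≋-refl
        (leads-+ (leads-+ (leads-* lb lb) (leads-raise (ℕ.<-≤-trans 2≤E (ℕ.<⇒≤ E<B+B)) leads-X))
          (leads-raise E<B+B le))
    -- Two replacements modulo N: A by -e gives the quotient g N′ and leaves -egN′ = -hbN′; in its
    -- part -2hb′b², replacing b² by -(X + e) gives the quotient -2hb′.
    ; quot     = (g *P deriv N) +P negP (v +P v)
    ; rem      = ((v +P v) *P (X +P e)) +P negP w
    ; division = isolate {(g *P A) *P deriv N} {v +P v} {g *P deriv N} {N} {w} {(v +P v) *P (X +P e)}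
        (begin
        (g *P A) *P deriv N +P ((v +P v) *P N +P w)
          ≈⟨ solve 8 (λ x b b′ h e e′ X o →
               x :+ ((h :* b′ :+ h :* b′) :* ((b :* b :+ X) :+ e) :+ (h :* b) :* (o :+ e′)) :=
               (x :+ (h :* b) :* (((b′ :* b :+ b :* b′) :+ o) :+ e′))
                 :+ (h :* b′ :+ h :* b′) :* (X :+ e))
               ≋-refl ((g *P A) *P deriv N) b (deriv b) h e (deriv e) X oneP ⟩
        ((g *P A) *P deriv N +P (h *P b) *P N′) +P (v +P v) *P (X +P e)
          ≈⟨ P.+-congʳ {(v +P v) *P (X +P e)} (+P-congˡ ((g *P A) *P deriv N)
               (*P-cong (≋-sym eg≋hb) (≋-sym deriv-N))) ⟩
        ((g *P A) *P deriv N +P (e *P g) *P deriv N) +P (v +P v) *P (X +P e)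
          ≈⟨ P.+-congʳ {(v +P v) *P (X +P e)}
               (solve 4 (λ g A n e → (g :* A) :* n :+ (e :* g) :* n := (g :* n) :* (A :+ e))
                 ≋-refl g A (deriv N) e) ⟩
        (g *P deriv N) *P N +P (v +P v) *P (X +P e) ∎)
    ; trace    = leads-resp degree leading shifted
        (leads-+ (leads-* (leads-+ hb′ hb′) X+e)
          (leads-neg (leads-* (leads-* lh lb) 1+e′))) }
    where
    A = b *P b +P X
    N = A +P e
    v = h *P deriv b
    w = (h *P b) *P (oneP +P deriv e)
    N′ = ((deriv b *P b +P b *P deriv b) +P oneP) +P deriv e

    deriv-N : deriv N ≋ N′
    deriv-N = ≋-trans (deriv-+ A e)
      (+P-cong (≋-trans (deriv-+ (b *P b) X) (+P-cong (deriv-* b b) deriv-X)) (≋-refl {deriv e}))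

    E≤B : E ≤ B
    E≤B = ≡.subst (E ≤_) H+E≡B (ℕ.m≤n+m E H)

    E<B+B : E < B ℕ.+ B
    E<B+B = ℕ.≤-<-trans E≤B (ℕ.m<m+n B (ℕ.<-≤-trans (ℕ.<-trans (s≤s z≤n) 2≤E) E≤B))

    hb′ : Leads (H ℕ.+ B) (1# * (natR B * 1#)) (h *P (0# ∷ deriv b))
    hb′ = leads-* lh (leads-0∷deriv lb)

    -- The bound 2 ≤ E keeps X strictly below the top of `e`; for E = 1 the two leading terms would
    -- add up.
    X+e : Leads E (0# + 1#) (X +P e)
    X+e = leads-+ (leads-raise 2≤E leads-X) le

    1+e′ : Leads E (0# + natR E * 1#) (X +P (0# ∷ deriv e))
    1+e′ = leads-+ (leads-raise 2≤E leads-X) (leads-0∷deriv le)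

    degree : (H ℕ.+ B) ℕ.+ E ≡ B ℕ.+ B
    degree = ≡.trans (≡.cong (ℕ._+ E) (ℕ.+-comm H B))
      (≡.trans (ℕ.+-assoc B H E) (≡.cong (B ℕ.+_) H+E≡B))

    leading : ((1# * (natR B * 1#) + 1# * (natR B * 1#)) * (0# + 1#)) - ((1# * 1#) * (0# + natR E * 1#))
              ≈ natR (B ℕ.+ B) - natR E
    leading = +-cong
      (trans (*-congˡ (+-identityˡ 1#)) (trans (*-identityʳ _)
        (trans (+-cong nB nB) (sym (natR-+ B B)))))
      (-‿cong (trans (*-congʳ (*-identityˡ 1#)) (trans (*-identityˡ _) (trans (+-identityˡ _) (*-identityʳ _)))))
      where
      nB : 1# * (natR B * 1#) ≈ natR B
      nB = trans (*-identityˡ _) (*-identityʳ _)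

    shifted : ((h *P (0# ∷ deriv b) +P h *P (0# ∷ deriv b)) *P (X +P e)
               +P negP ((h *P b) *P (X +P (0# ∷ deriv e))))
              ≋ (0# ∷ ((v +P v) *P (X +P e) +P negP w))
    shifted = begin
      (h *P (0# ∷ deriv b) +P h *P (0# ∷ deriv b)) *P (X +P e)
        +P negP ((h *P b) *P (X +P (0# ∷ deriv e)))
        ≈⟨ +P-cong (*P-congʳ (X +P e) (+P-cong (*P-congˡ h (X-*P (deriv b))) (*P-congˡ h (X-*P (deriv b)))))
             (negP-cong (*P-congˡ (h *P b) (+P-congˡ X (X-*P (deriv e))))) ⟨
      (h *P (X *P deriv b) +P h *P (X *P deriv b)) *P (X +P e)
        +P negP ((h *P b) *P (X +P X *P deriv e))
        ≈⟨ +P-cong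
             (solve 4 (λ h X b′ e →
               (h :* (X :* b′) :+ h :* (X :* b′)) :* (X :+ e) := X :* ((h :* b′ :+ h :* b′) :* (X :+ e)))
               ≋-refl h X (deriv b) e)
             (negP-cong (solve 4 (λ h b X e′ → (h :* b) :* (X :+ X :* e′) := X :* ((h :* b) :* (con 1 :+ e′)))
               ≋-refl h b X (deriv e))) ⟩
      X *P ((v +P v) *P (X +P e)) +P negP (X *P w)
        ≈⟨ +P-congˡ (X *P ((v +P v) *P (X +P e))) (P-Ring.-‿distribʳ-* X w) ⟩
      X *P ((v +P v) *P (X +P e)) +P X *P negP w
        ≈⟨ proj₁ P.distrib X ((v +P v) *P (X +P e)) (negP w) ⟨
      X *P ((v +P v) *P (X +P e) +P negP w)
        ≈⟨ X-*P ((v +P v) *P (X +P e) +P negP w) ⟩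
      0# ∷ ((v +P v) *P (X +P e) +P negP w) ∎

-- Divisibility, degrees and products along the critical orbit.

module CriticalOrbit {c ℓ} (R : CommutativeRing c ℓ) where
  open CommutativeRing R
  open PolyOver R
  open Polynomials R
  open Traces R
  open import Algebra.Properties.Ring ring
  open Rearrangement R using (subtractʳ)
  open import Algebra.Solver.Ring.NaturalCoefficients.Default P.commutativeSemiring
    using (solve; _:+_; _:*_; _:=_; con)
  open import Relation.Binary.Reasoning.Setoid setoid

  leads-aP : ∀ i → Leads (2 ^ i) 1# (aP (suc i))
  leads-aP zero    = leads-X
  leads-aP (suc i) = leads-resp (≡.cong (2 ^ i ℕ.+_) (≡.sym (ℕ.+-identityʳ (2 ^ i))))
    (trans (+-identityʳ _) (*-identityˡ 1#)) ≋-refl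
    (leads-+ (leads-* (leads-aP i) (leads-aP i))
      (leads-raise (ℕ.+-mono-≤ (ℕ.m^n>0 2 i) (ℕ.m^n>0 2 i)) leads-X))

  eval-aP : ∀ i γ → eval (aP i) γ ≈ aV i γ
  eval-aP zero    γ = refl
  eval-aP (suc i) γ = trans (eval-+ (aP i *P aP i) X γ)
    (+-cong (trans (eval-* (aP i) (aP i) γ) (*-cong (eval-aP i γ) (eval-aP i γ))) (eval-X γ))

  -- Modulo a_p the orbit of 0 is back at 0 after p steps and then repeats. Squaring and adding X
  -- preserves the congruence.
  aP-+ : ∀ p j → ∃ λ u → aP (p ℕ.+ j) ≋ u *P aP p +P aP j
  aP-+ p zero    rewrite ℕ.+-identityʳ p =
    oneP , ≋-sym (≋-trans (+P-identityʳ (oneP *P aP p)) (*P-identityˡ (aP p)))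
  aP-+ p (suc j) rewrite ℕ.+-suc p j with aP-+ p j
  ... | u , e = (u *P u) *P aP p +P (u *P aP j +P u *P aP j) ,
    ≋-trans (P.+-congʳ {X} (*P-cong e e))
      (solve 4 (λ u a b X →
        (u :* a :+ b) :* (u :* a :+ b) :+ X :=
        ((u :* u) :* a :+ (u :* b :+ u :* b)) :* a :+ (b :* b :+ X))
        ≋-refl u (aP p) (aP j) X)

  ∣⇒aP∣aP : ∀ {p n} → p ∣ n → ∃ λ u → aP n ≋ u *P aP p
  ∣⇒aP∣aP {p} (divides q ≡.refl) = go q
    where
    go : ∀ q → ∃ λ u → aP (q ℕ.* p) ≋ u *P aP p
    go zero    = [] , ≋-refl
    go (suc q) with go q | aP-+ p (q ℕ.* p)
    ... | u , e | v , f = v +P u , ≋-trans f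
      (≋-trans (+P-congˡ (v *P aP p) e) (≋-sym (*P-distribʳ (aP p) v u)))

  -- The polynomial a_s ⋯ a_{s+l-1}; its values are those of `lam` without the power of 2.
  orbitProd : ℕ → ℕ → Poly
  orbitProd s zero    = oneP
  orbitProd s (suc l) = aP s *P orbitProd (suc s) l

  orbitProd-snoc : ∀ s l → orbitProd s (suc l) ≋ orbitProd s l *P aP (s ℕ.+ l)
  orbitProd-snoc s zero    rewrite ℕ.+-identityʳ s = *P-comm (aP s) oneP
  orbitProd-snoc s (suc l) rewrite ℕ.+-suc s l = ≋-trans
    (*P-congˡ (aP s) (orbitProd-snoc (suc s) l))
    (≋-sym (*P-assoc (aP s) (orbitProd (suc s) l) (aP (suc s ℕ.+ l))))

  -- The degree is the geometric sum 2^s + ⋯ + 2^{s+l-1} = 2^{s+l} - 2^s, written additively to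
  -- match the hypothesis H + E = B of `trace-iterate`.
  leads-orbitProd : ∀ s l → ∃ λ H → H ℕ.+ 2 ^ s ≡ 2 ^ (s ℕ.+ l) × Leads H 1# (orbitProd (suc s) l)
  leads-orbitProd s zero    = 0 , ≡.cong (2 ^_) (≡.sym (ℕ.+-identityʳ s)) , Trace.monic (trace-one [])
  leads-orbitProd s (suc l) with leads-orbitProd (suc s) l
  ... | H , H+ , lH = 2 ^ s ℕ.+ H ,
    ≡.trans rearranged (≡.trans H+ (≡.cong (2 ^_) (≡.sym (ℕ.+-suc s l)))) ,
    leads-resp ≡.refl (*-identityˡ 1#) ≋-refl (leads-* (leads-aP s) lH)
    where
    rearranged : 2 ^ s ℕ.+ H ℕ.+ 2 ^ s ≡ H ℕ.+ 2 ^ suc s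
    rearranged = ≡.trans (≡.cong (ℕ._+ 2 ^ s) (ℕ.+-comm (2 ^ s) H))
      (≡.trans (ℕ.+-assoc H (2 ^ s) (2 ^ s))
        (≡.cong (λ t → H ℕ.+ (2 ^ s ℕ.+ t)) (≡.sym (ℕ.+-identityʳ (2 ^ s)))))

  eval-orbitProd : ∀ s l γ → prodR (map (λ i → aV (s ℕ.+ i) γ) (upTo l)) ≈ eval (orbitProd s l) γ
  eval-orbitProd s l γ = trans (reflexive (≡.cong prodR (map-upTo (λ i → aV (s ℕ.+ i) γ) l)))
    (go s l (λ i → reflexive ≡.refl))
    where
    -- `applyUpTo` composes its function with `suc` where `orbitProd` raises `s`, so the function is
    -- allowed to vary up to pointwise equality.
    go : ∀ s l {f} → (∀ i → f i ≈ aV (s ℕ.+ i) γ) → prodR (applyUpTo f l) ≈ eval (orbitProd s l) γ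
    go s zero    e = sym (trans (+-congˡ (zeroʳ γ)) (+-identityʳ 1#))
    go s (suc l) {f} e = begin
      f 0 * prodR (applyUpTo (f ∘ suc) l)
        ≈⟨ *-cong (trans (e 0) (reflexive (≡.cong (λ i → aV i γ) (ℕ.+-identityʳ s))))
             (go (suc s) l (λ i → trans (e (suc i)) (reflexive (≡.cong (λ i → aV i γ) (ℕ.+-suc s i))))) ⟩
      aV s γ * eval (orbitProd (suc s) l) γ
        ≈⟨ *-congʳ (eval-aP s γ) ⟨
      eval (aP s) γ * eval (orbitProd (suc s) l) γ
        ≈⟨ eval-* (aP s) (orbitProd (suc s) l) γ ⟨
      eval (aP s *P orbitProd (suc s) l) γ ∎

  -- With m = 2 + k and p = l + 1, `trace-iterate` is applied to b = a_{m+p-2}, e = a_{m-1}, g = a_m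
  -- ⋯ a_{m+p-2} and h = a_{m-1} ⋯ a_{m+p-3}. The relation eg = hb is one product, a_{m-1} ⋯
  -- a_{m+p-2}, opened at either end.
  trace-orbitProd : ∀ k l → 1 ≤ k →
    Trace (orbitProd (2 ℕ.+ k) (suc l)) (aP (2 ℕ.+ (k ℕ.+ l)) +P aP (suc k))
      (2 ^ (k ℕ.+ l) ℕ.+ 2 ^ (k ℕ.+ l)) (natR (2 ^ (k ℕ.+ l) ℕ.+ 2 ^ (k ℕ.+ l)) - natR (2 ^ k))
  trace-orbitProd (suc k) l _ with leads-orbitProd (suc k) l
  ... | H , H+ , lH = trace-respˡ (≋-sym (orbitProd-snoc (3 ℕ.+ k) l))
    (trace-iterate {g = orbitProd (3 ℕ.+ k) l} (leads-aP (suc k ℕ.+ l)) (leads-aP (suc k)) lH H+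
      (ℕ.*-monoʳ-≤ 2 (ℕ.m^n>0 2 k)) (orbitProd-snoc (2 ℕ.+ k) l))

  -- Values at the roots of a_m + a_{m-1}.

  roots-vanish : ∀ γs → All (λ γ → eval (rootsPoly γs) γ ≈ 0#) γs
  roots-vanish []       = []
  roots-vanish (γ ∷ γs) =
    trans (eval-* (linear γ) (rootsPoly γs) γ) (trans (*-congʳ linear-vanish) (zeroˡ _))
    ∷ All.map (λ {δ} e → trans (eval-* (linear γ) (rootsPoly γs) δ) (trans (*-congˡ e) (zeroʳ _)))
        (roots-vanish γs)
    where
    linear-vanish : eval (linear γ) γ ≈ 0#
    linear-vanish = begin
      eval (X +P constP (- γ)) γ                ≈⟨ eval-+ X (constP (- γ)) γ ⟩
      eval X γ + (- γ + γ * 0#)                 ≈⟨ +-cong (eval-X γ) (trans (+-congˡ (zeroʳ γ)) (+-identityʳ _)) ⟩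
      γ - γ                                     ≈⟨ -‿inverseʳ γ ⟩
      0#                                        ∎

  square-neg : ∀ {x y} → x ≈ - y → x * x ≈ y * y
  square-neg {x} {y} e = begin
    x * x          ≈⟨ *-cong e e ⟩
    (- y) * (- y)  ≈⟨ -‿distribˡ-* y (- y) ⟨
    - (y * - y)    ≈⟨ -‿cong (-‿distribʳ-* y y) ⟨
    - - (y * y)    ≈⟨ -‿involutive (y * y) ⟩
    y * y          ∎

  powR-neg : ∀ j {x y} → x ≈ - y → powR x (suc (j ℕ.* 2)) ≈ - powR y (suc (j ℕ.* 2))
  powR-neg j {x} {y} e = trans (*-cong e (even j)) (sym (-‿distribˡ-* y _))
    where
    even : ∀ j → powR x (j ℕ.* 2) ≈ powR y (j ℕ.* 2)
    even zero    = refl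
    even (suc j) = begin
      x * (x * powR x (j ℕ.* 2))  ≈⟨ *-assoc x x _ ⟨
      (x * x) * powR x (j ℕ.* 2)  ≈⟨ *-cong (square-neg e) (even j) ⟩
      (y * y) * powR y (j ℕ.* 2)  ≈⟨ *-assoc y y _ ⟩
      y * (y * powR y (j ℕ.* 2))  ∎

  -- At a root β of a_{s+1} + a_s the critical orbit is constant from a_{s+1} on.
  orbitProd-at-root : ∀ s l {β} → aV (suc s) β ≈ - aV s β →
    eval (orbitProd (suc s) l) β ≈ powR (aV (suc s) β) l
  orbitProd-at-root s l {β} e = go (suc s) l refl
    where
    go : ∀ t l → aV t β ≈ aV (suc s) β → eval (orbitProd t l) β ≈ powR (aV (suc s) β) l
    go t zero    f = trans (+-congˡ (zeroʳ β)) (+-identityʳ 1#)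
    go t (suc l) f = trans (eval-* (aP t) (orbitProd (suc t) l) β)
      (*-cong (trans (eval-aP t β) f)
        (go (suc t) l (+-congʳ (trans (*-cong f f) (square-neg e)))))

  -- Every factor takes the value -a_s(β), and the number of factors is odd.
  sum-over-roots : ∀ s j βs → (aP (suc s) +P aP s) ≋ rootsPoly βs →
    sumR (map (eval (orbitProd (suc s) (suc (j ℕ.* 2)))) βs)
      ≈ - sumR (map (λ β → powR (aV s β) (suc (j ℕ.* 2))) βs)
  sum-over-roots s j βs D≋ = go (All.map at-root (roots-vanish βs))
    where
    at-root : ∀ {β} → eval (rootsPoly βs) β ≈ 0# →
      eval (orbitProd (suc s) (suc (j ℕ.* 2))) β ≈ - powR (aV s β) (suc (j ℕ.* 2))
    at-root {β} root = trans (orbitProd-at-root s (suc (j ℕ.* 2)) e) (powR-neg j e)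
      where
      e : aV (suc s) β ≈ - aV s β
      e = trans (subtractʳ (begin
        aV (suc s) β + aV s β                  ≈⟨ +-cong (eval-aP (suc s) β) (eval-aP s β) ⟨
        eval (aP (suc s)) β + eval (aP s) β    ≈⟨ eval-+ (aP (suc s)) (aP s) β ⟨
        eval (aP (suc s) +P aP s) β            ≈⟨ eval-cong D≋ β ⟩
        eval (rootsPoly βs) β                  ≈⟨ root ⟩
        0#                                     ∎)) (+-identityˡ _)

    go : ∀ {f g γs} → All (λ γ → f γ ≈ - g γ) γs → sumR (map f γs) ≈ - sumR (map g γs)
    go []       = sym -0#≈0#
    go (e ∷ es) = trans (+-cong e (go es)) (-‿+-comm _ _)

  -- Sums over the roots of G.

  sum-lam : ∀ m n γs →
    sumR (map (lam m n) γs) ≈ natR (2 ^ n) * sumR (map (eval (orbitProd m n)) γs)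
  sum-lam m n []       = sym (zeroʳ _)
  sum-lam m n (γ ∷ γs) =
    trans (+-cong (*-congˡ (eval-orbitProd m n γ)) (sum-lam m n γs)) (sym (distribˡ _ _ _))

  -- A prime p has only the divisors p, with Möbius sign +, and 1, with sign -. The relation stays
  -- multiplied out, because traces turn products into sums on both sides.
  G-relation : ∀ m {p G} → Prime p → IsG m p G →
    G *P termP m 1 ≋ termP m p ⊎ (p ∣ m ∸ 1 × (G *P termP m 1) *P aP p ≋ termP m p *P X)
  G-relation m {p} {G} pp isG = simplify (p ∣? (m ∸ 1))
    (≡.subst₂ (λ plus minus → Relation plus minus (does (p ∣? (m ∸ 1))))
      (divsMobPlus-prime pp) (divsMobMinus-prime pp) isG)
    where
    -- `IsG` with both divisor lists and the divisibility test abstracted: the lists can then be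
    -- substituted, and the decision analysed by cases.
    Relation : List ℕ → List ℕ → Bool → Set _
    Relation plus minus b =
      (G *P (prodP (map (termP m) minus) *P (if b then prodP (map aP plus) else oneP)))
        ≈P (prodP (map (termP m) plus) *P (if b then prodP (map aP minus) else oneP))

    D N : Poly
    D = termP m 1
    N = termP m p

    simplify : (d : Dec (p ∣ m ∸ 1)) → Relation (p ∷ []) (1 ∷ []) (does d) →
      G *P D ≋ N ⊎ (p ∣ m ∸ 1 × (G *P D) *P aP p ≋ N *P X)
    simplify (no _) e = inj₁ (≋-trans
      (solve 2 (λ g d → g :* d := g :* ((d :* con 1) :* con 1)) ≋-refl G D)
      (≋-trans (≈P⇒≋ e) (solve 1 (λ n → (n :* con 1) :* con 1 := n) ≋-refl N)))
    simplify (yes p∣m-1) e = inj₂ (p∣m-1 , ≋-trans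
      (solve 3 (λ g d a → (g :* d) :* a := g :* ((d :* con 1) :* (a :* con 1))) ≋-refl G D (aP p))
      (≋-trans (≈P⇒≋ e) (solve 2 (λ n x → (n :* con 1) :* (x :* con 1) := n :* x) ≋-refl N X)))

  -- The extra factors a_p and a_1 of the case p ∣ m − 1 divide orbitProd m p, so
  -- they do not contribute to the trace.
  sum-over-G : ¬ (1# ≈ 0#) → ∀ k l → 1 ≤ k → Prime (suc l) → ∀ {G αs βs} →
    IsG (2 ℕ.+ k) (suc l) G → G ≋ rootsPoly αs → (aP (2 ℕ.+ k) +P aP (suc k)) ≋ rootsPoly βs →
    sumR (map (eval (orbitProd (2 ℕ.+ k) (suc l))) αs)
      + sumR (map (eval (orbitProd (2 ℕ.+ k) (suc l))) βs)
      ≈ natR (2 ^ (k ℕ.+ l) ℕ.+ 2 ^ (k ℕ.+ l)) - natR (2 ^ k)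
  sum-over-G 1≉0 k l 1≤k pp {G} {αs} {βs} isG G≋ D≋ = compare (G-relation (2 ℕ.+ k) {G = G} pp isG)
    where
    p = suc l
    f = orbitProd (2 ℕ.+ k) p
    D = termP (2 ℕ.+ k) 1
    N = termP (2 ℕ.+ k) p

    N≡ : aP (2 ℕ.+ (k ℕ.+ l)) +P aP (suc k) ≡ N
    N≡ = ≡.cong (λ i → aP (suc i) +P aP (suc k)) (≡.sym (ℕ.+-suc k l))

    D≡ : aP (2 ℕ.+ k) +P aP (suc k) ≡ D
    D≡ = ≡.cong (λ i → aP (suc i) +P aP (suc k)) (≡.sym (ℕ.+-comm k 1))

    trace-N : Trace f N _ (natR (2 ^ (k ℕ.+ l) ℕ.+ 2 ^ (k ℕ.+ l)) - natR (2 ^ k))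
    trace-N = ≡.subst (λ q → Trace f q _ (natR (2 ^ (k ℕ.+ l) ℕ.+ 2 ^ (k ℕ.+ l)) - natR (2 ^ k))) N≡ (trace-orbitProd k l 1≤k)

    trace-GD : Trace f (G *P D) _ (sumR (map (eval f) αs) + sumR (map (eval f) βs))
    trace-GD = trace-resp
      (≋-sym (*P-cong G≋ (≡.subst (_≋ rootsPoly βs) D≡ D≋))) refl
      (trace-* (trace-rootsPoly f αs) (trace-rootsPoly f βs))

    -- `suc k + p` is m + p - 1, the index of the last factor of `f`. Both 1 and, if p divides m -
    -- 1, also p divide this index, so a_1 and a_p divide that factor.
    trace-aP : ∀ i → suc i ∣ suc k ℕ.+ p → Trace f (aP (suc i)) (2 ^ i) 0#
    trace-aP i i∣ with ∣⇒aP∣aP i∣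
    ... | u , e = trace-multiple (orbitProd (2 ℕ.+ k) l *P u) (leads-aP i)
      (≋-trans (orbitProd-snoc (2 ℕ.+ k) l)
        (≋-trans (*P-congˡ (orbitProd (2 ℕ.+ k) l)
            (≡.subst (λ j → aP j ≋ u *P aP (suc i)) (≡.cong suc (ℕ.+-suc k l)) e))
          (≋-sym (*P-assoc (orbitProd (2 ℕ.+ k) l) u (aP (suc i))))))

    compare : G *P D ≋ N ⊎ (p ∣ suc k × (G *P D) *P aP p ≋ N *P X) → _
    compare (inj₁ GD≋N) = trace-unique 1≉0 (trace-resp GD≋N refl trace-GD) trace-N
    compare (inj₂ (p∣ , GDa≋NX)) = trace-unique 1≉0
      (trace-resp GDa≋NX (+-identityʳ _) (trace-* trace-GD (trace-aP l (∣m∣n⇒∣m+n p∣ ∣-refl))))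
      (trace-resp ≋-refl (+-identityʳ _) (trace-* trace-N (trace-aP 0 (1∣ _))))

theorem2p9 : ∀ {c ℓ} (R : CommutativeRing c ℓ) →
    let open CommutativeRing R in
    let open PolyOver R in
    IsDomain → CharZero →
    (m p : ℕ) → 3 ≤ m → Prime p → 3 ≤ p →
    (G : Poly) (αs βs : List Carrier) →
    IsG m p G →
    G ≈P rootsPoly αs →
    (aP m +P aP (m ∸ 1)) ≈P rootsPoly βs →
    sumR (map (lam m p) αs)
    ≈ natR (2 ^ p) * (sumR (map (λ β → powR (aV (m ∸ 1) β) p) βs)
    + natR (2 ^ (m ℕ.+ p ∸ 2)) - natR (2 ^ (m ∸ 2)))
theorem2p9 R (1≉0 , _) _ (suc (suc k)) p (s≤s (s≤s 1≤k)) pp 3≤p G αs βs isG G≈ D≈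
  with prime⇒odd pp 3≤p
... | j , ≡.refl = begin
  sumR (map (lam m p) αs)
    ≈⟨ sum-lam m p αs ⟩
  natR (2 ^ p) * sumR (map (eval f) αs)
    ≈⟨ *-congˡ (begin
         sumR (map (eval f) αs)
           ≈⟨ subtractʳ (sum-over-G 1≉0 k l 1≤k pp {G} {αs} {βs} isG (≈P⇒≋ G≈) (≈P⇒≋ D≈)) ⟩
         (natR d - natR (2 ^ k)) - sumR (map (eval f) βs)
           -- The sum over the roots of a_m + a_{m-1} is subtracted and is itself -S, so S enters
           -- with a plus sign.
           ≈⟨ +-congˡ (trans (-‿cong (sum-over-roots (suc k) j βs (≈P⇒≋ D≈))) (-‿involutive S)) ⟩
         (natR d - natR (2 ^ k)) + S     ≈⟨ +-comm _ S ⟩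
         S + (natR d - natR (2 ^ k))     ≈⟨ +-assoc S _ _ ⟨
         S + natR d - natR (2 ^ k)       ≈⟨ +-congʳ (+-congˡ (reflexive (≡.cong natR d≡))) ⟩
         S + natR (2 ^ (k ℕ.+ p)) - natR (2 ^ k) ∎) ⟩
  natR (2 ^ p) * (S + natR (2 ^ (k ℕ.+ p)) - natR (2 ^ k)) ∎
  where
  open CommutativeRing R
  open PolyOver R
  open Polynomials R
  open CriticalOrbit R
  open Rearrangement R using (subtractʳ)
  open import Algebra.Properties.Ring ring
  open import Relation.Binary.Reasoning.Setoid setoid
  m = 2 ℕ.+ k
  l = j ℕ.* 2
  f = orbitProd m p
  S = sumR (map (λ β → powR (aV (suc k) β) p) βs)
  d = 2 ^ (k ℕ.+ l) ℕ.+ 2 ^ (k ℕ.+ l)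

  -- `d` is deg N in the doubled form left by squaring a_{m+p-2}; k + p is m + p - 2.
  d≡ : d ≡ 2 ^ (k ℕ.+ p)
  d≡ = ≡.trans (≡.cong (2 ^ (k ℕ.+ l) ℕ.+_) (≡.sym (ℕ.+-identityʳ _)))
    (≡.cong (2 ^_) (≡.sym (ℕ.+-suc k l)))
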